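{- Let $\theta\in\mathsf{PTML}^2$ be a sentence in $\mathsf{FSNF}$ $\mathsf{DNF}$. Then $\theta$ is satisfiable if and only if $\theta$ is satisfiable in a model with a bounded number of agents, i.e. in a model whose set of agents is finite and of size bounded by a function of $\theta$ alone.
   Context: $\mathsf{PTML}^2$ is the two-variable propositional term modal logic: over a set of propositions and the two variables $x,y$, formulas are $\phi::= p \mid \neg\phi\mid\phi\land\phi\mid\phi\lor\phi\mid\exists z\,\phi\mid\forall z\,\phi\mid\Box_z\phi\mid\Diamond_z\phi$ with $z\in\{x,y\}$; a sentence has no free variables, where $\mathsf{Fv}(\Box_z\phi)=\mathsf{Fv}(\Diamond_z\phi)=\mathsf{Fv}(\phi)\cup\{z\}$. Models are $M=(W,D,\delta,R,\rho)$ with $W$ non-empty countable, $D$ a non-empty countable set of agents, $R\subseteq W\times D\times W$, $\delta:W\to2^D$ giving non-empty local domains with $(w,d,v)\in R\Rightarrow d\in\delta(w)\subseteq\delta(v)$, and $\rho(w)$ the set of propositions true at $w$. Semantics: $p$ holds at $w$ iff $p\in\rho(w)$; Booleans as usual; $\exists z\,\phi$ holds iff $\phi$ holds with $z$ assigned some $d\in\delta(w)$ (dually $\forall$); $\Box_z\phi$ holds iff $\phi$ holds at all $v$ with $(w,\sigma(z),v)\in R$ (dually $\Diamond_z$). A sentence is satisfiable if it holds at some world of some model. Formulas are in negation normal form. A literal is a proposition or its negation; a module is a literal or a formula $\Box_z\alpha$ or $\Diamond_z\alpha$. $\mathsf{C}(\phi)$: $\mathsf{C}(\phi)=\{\phi\}$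 if $\phi$ is a module or of the form $Qz\,\phi'$, $Q\in\{\forall,\exists\}$; $\mathsf{C}(\phi\odot\psi)=\mathsf{C}(\phi)\cup\mathsf{C}(\psi)$ for $\odot\in\{\land,\lor\}$. A formula is quantifier-safe if every member of $\mathsf{C}(\phi)$ is a module. Inductively: conjunctions of literals are $\mathsf{FSNF}$ conjunctions; disjunctions of $\mathsf{FSNF}$ conjunctions are in $\mathsf{FSNF}$ $\mathsf{DNF}$; a quantifier-safe $\phi$ such that for every $\Delta_z\psi\in\mathsf{C}(\phi)$, $\psi$ is in $\mathsf{FSNF}$ $\mathsf{DNF}$, is a quantifier-safe normal formula; and with literals $s_i$, formulas $\alpha^z,\beta^z_j$ in $\mathsf{FSNF}$ $\mathsf{DNF}$ and quantifier-safe normal formulas $\gamma^{z},\delta^{z}_k,\phi,\psi_l$, the formula $\bigwedge_{i\le a}s_i\land\bigwedge_{z\in\{x,y\}}(\Box_z\alpha^z\land\bigwedge_{j\le m_z}\Diamond_z\beta^z_j)\land\bigwedge_{z_1\in\{x,y\}}(\forall z_2\,\gamma^{z_1}\land\bigwedge_{k\le n_{z_1}}\exists z_2\,\delta^{z_1}_k)\land\forall x\forall y\,\phi\land\bigwedge_{l\le b}\forall x\exists y\,\psi_l$ is an $\mathsf{FSNF}$ conjunction ($z_2$ the variable other than $z_1$; all indices $\ge0$; the conjuncts $\Box_z\alpha^z$, $\forall z_2\gamma^{z_1}$, $\forall x\forall y\,\phi$ may be absent). -}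

module Defs where

open import Data.Nat using (ℕ)
open import Data.Fin using (Fin)
open import Data.List using (List; []; _∷_; _++_; length; lookup)
open import Data.List.Relation.Unary.All using (All)
open import Data.Product using (Σ; ∃; ∃-syntax; _×_; _,_)
open import Data.Sum using (_⊎_)
open import Relation.Nullary using (¬_)
open import Relation.Binary.PropositionalEquality using (_≡_; _≢_)
open import Function.Definitions using (Injective)

data Var : Set where
  vx vy : Var

Prop : Set
Prop = ℕ

infixr 6 _∧'_
infixr 5 _∨'_

data Form : Set where
  pos  : Prop → Form
  neg  : Prop → Form
  _∧'_ : Form → Form → Form
  _∨'_ : Form → Form → Form
  ex   : Var → Form → Form
  all  : Var → Form → Form
  box  : Var → Form → Form
  dia  : Var → Form → Form

data Free (z : Var) : Form → Set where
  and-l : ∀ {φ ψ} → Free z φ → Free z (φ ∧' ψ)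
  and-r : ∀ {φ ψ} → Free z ψ → Free z (φ ∧' ψ)
  or-l  : ∀ {φ ψ} → Free z φ → Free z (φ ∨' ψ)
  or-r  : ∀ {φ ψ} → Free z ψ → Free z (φ ∨' ψ)
  ex-in  : ∀ {z' φ} → z ≢ z' → Free z φ → Free z (ex z' φ)
  all-in : ∀ {z' φ} → z ≢ z' → Free z φ → Free z (all z' φ)
  box-here : ∀ {φ} → Free z (box z φ)
  box-in   : ∀ {z' φ} → Free z φ → Free z (box z' φ)
  dia-here : ∀ {φ} → Free z (dia z φ)
  dia-in   : ∀ {z' φ} → Free z φ → Free z (dia z' φ)

Sentence : Form → Set
Sentence φ = ∀ z → ¬ Free z φ

data InC : Form → Form → Set where
  c-pos : ∀ {p} → InC (pos p) (pos p)
  c-neg : ∀ {p} → InC (neg p) (neg p)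
  c-box : ∀ {z φ} → InC (box z φ) (box z φ)
  c-dia : ∀ {z φ} → InC (dia z φ) (dia z φ)
  c-ex  : ∀ {z φ} → InC (ex z φ) (ex z φ)
  c-all : ∀ {z φ} → InC (all z φ) (all z φ)
  c-and-l : ∀ {χ φ ψ} → InC χ φ → InC χ (φ ∧' ψ)
  c-and-r : ∀ {χ φ ψ} → InC χ ψ → InC χ (φ ∧' ψ)
  c-or-l  : ∀ {χ φ ψ} → InC χ φ → InC χ (φ ∨' ψ)
  c-or-r  : ∀ {χ φ ψ} → InC χ ψ → InC χ (φ ∨' ψ)

conjuncts : Form → List Form
conjuncts (φ ∧' ψ) = conjuncts φ ++ conjuncts ψ
conjuncts φ        = φ ∷ []

disjuncts : Form → List Form
disjuncts (φ ∨' ψ) = disjuncts φ ++ disjuncts ψ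
disjuncts φ        = φ ∷ []

AtMostOne : (Form → Set) → List Form → Set
AtMostOne P L = (i j : Fin (length L)) → P (lookup L i) → P (lookup L j) → i ≡ j

IsBox : Var → Form → Set
IsBox z ψ = ∃[ α ] (ψ ≡ box z α)

IsQuant : Form → Set
IsQuant γ = ∃[ z ] ∃[ χ ] (γ ≡ all z χ ⊎ γ ≡ ex z χ)

IsAll1 : Var → Form → Set
IsAll1 z ψ = ∃[ γ ] (ψ ≡ all z γ × ¬ IsQuant γ)

IsAllAll : Form → Set
IsAllAll ψ = ∃[ φ ] (ψ ≡ all vx (all vy φ))

mutual
  data ModuleOK : Form → Set where
    m-pos : ∀ {p} → ModuleOK (pos p)
    m-neg : ∀ {p} → ModuleOK (neg p)
    m-box : ∀ {z α} → FSNFDNF α → ModuleOK (box z α)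
    m-dia : ∀ {z α} → FSNFDNF α → ModuleOK (dia z α)

  data QSNormal (φ : Form) : Set where
    qsn : (∀ ψ → InC ψ φ → ModuleOK ψ) → QSNormal φ

  data ConjOK : Form → Set where
    k-pos : ∀ {p} → ConjOK (pos p)
    k-neg : ∀ {p} → ConjOK (neg p)
    k-box : ∀ {z α} → FSNFDNF α → ConjOK (box z α)
    k-dia : ∀ {z β} → FSNFDNF β → ConjOK (dia z β)
    k-all : ∀ {z γ} → QSNormal γ → ConjOK (all z γ)
    k-ex  : ∀ {z δ} → QSNormal δ → ConjOK (ex z δ)
    k-allall : ∀ {φ} → QSNormal φ → ConjOK (all vx (all vy φ))
    k-allex  : ∀ {ψ} → QSNormal ψ → ConjOK (all vx (ex vy ψ))

  data FSNFConj (φ : Form) : Set where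
    fsnf-conj : All ConjOK (conjuncts φ)
              → AtMostOne (IsBox vx) (conjuncts φ)
              → AtMostOne (IsBox vy) (conjuncts φ)
              → AtMostOne (IsAll1 vx) (conjuncts φ)
              → AtMostOne (IsAll1 vy) (conjuncts φ)
              → AtMostOne IsAllAll (conjuncts φ)
              → FSNFConj φ

  data FSNFDNF (φ : Form) : Set where
    fsnf-dnf : All FSNFConj (disjuncts φ) → FSNFDNF φ

Countable : Set → Set
Countable A = Σ (A → ℕ) (Injective _≡_ _≡_)

record Model : Set₁ where
  field
    W : Set
    D : Set
    δ : W → D → Set
    R : W → D → W → Set
    ρ : W → Prop → Set
    W-countable : Countable W
    D-countable : Countable D
    W-nonempty  : W
    D-nonempty  : D
    δ-nonempty  : ∀ w → ∃[ d ] δ w d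
    R-agent     : ∀ {w d v} → R w d v → δ w d
    R-mono      : ∀ {w d v} → R w d v → ∀ {e} → δ w e → δ v e

module _ (M : Model) where
  open Model M

  _[_↦_] : (Var → D) → Var → D → Var → D
  (σ [ vx ↦ d ]) vx = d
  (σ [ vx ↦ d ]) vy = σ vy
  (σ [ vy ↦ d ]) vx = σ vx
  (σ [ vy ↦ d ]) vy = d

  Sat : W → (Var → D) → Form → Set
  Sat w σ (pos p)  = ρ w p
  Sat w σ (neg p)  = ¬ ρ w p
  Sat w σ (φ ∧' ψ) = Sat w σ φ × Sat w σ ψ
  Sat w σ (φ ∨' ψ) = Sat w σ φ ⊎ Sat w σ ψ
  Sat w σ (ex z φ)  = ∃[ d ] (δ w d × Sat w (σ [ z ↦ d ]) φ)
  Sat w σ (all z φ) = ∀ d → δ w d → Sat w (σ [ z ↦ d ]) φ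
  Sat w σ (box z φ) = ∀ v → R w (σ z) v → Sat v σ φ
  Sat w σ (dia z φ) = ∃[ v ] (R w (σ z) v × Sat v σ φ)

Satisfiable : Form → Set₁
Satisfiable θ = Σ Model λ M → ∃[ w ] ∃[ σ ] Sat M w σ θ

SatisfiableWithAgents≤ : ℕ → Form → Set₁
SatisfiableWithAgents≤ n θ =
  Σ Model λ M → Σ (Model.D M → Fin n) (Injective _≡_ _≡_) × (∃[ w ] ∃[ σ ] Sat M w σ θ)

{-# OPTIONS --safe #-}

-- Fix the finite set Φ of modal subformulas of θ.  At a world, the type of a pair
-- of agents says which members of Φ hold of it, and the star of an agent is the set of types
-- it forms with the agents present.  A world w with a map f from finitely many
-- agents into its domain is imitated by adding, for every star, every type and three phases, a
-- fresh agent mapped to a representative of that star.  An agent of phase i gets each type of its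
-- star realised by a fresh agent of phase i + 1; the cyclic order keeps two agents from
-- prescribing the type of the same pair.  An a-successor of the imitation imitates an
-- f(a)-successor of w, under a new map which keeps f(a) and moves every other agent b to one that
-- forms with f(a) the type assigned to (a , b).  By induction on the modal depth
-- this yields a tree whose agents number at most a function of θ.
-- Types and stars of the given model are available only under a double negation.  It is
-- removed at the end, since there are finitely many trees and satisfaction in them is decidable.

module Submission where

open import Defs
open import Data.Nat using (ℕ; zero; suc; _*_; _^_; _⊔_; _≤_; z≤n; s≤s; _≟_; _≤?_)
open import Data.Nat.Properties using (≤-refl; ≤-trans; ≤-reflexive; n≤1+n; 1+n≰n;
  m⊔n≤o⇒m≤o; m⊔n≤o⇒n≤o; suc-injective)
open import Data.Fin using (Fin; zero; suc; toℕ; fromℕ<; combine; remQuot; finToFun; funToFin)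
import Data.Fin.Properties as Fin
open import Data.List using (List; []; _∷_; _++_; length; lookup)
open import Data.List.Membership.Propositional using (_∈_)
open import Data.List.Relation.Binary.Subset.Propositional using (_⊆_)
open import Data.List.Relation.Binary.Subset.Propositional.Properties
  using (⊆-refl; xs⊆xs++ys; xs⊆ys++xs; xs⊆x∷xs)
open import Data.List.Relation.Unary.All using (All; []; _∷_)
open import Data.List.Relation.Unary.All.Properties using (++⁻ˡ; ++⁻ʳ)
open import Data.List.Relation.Unary.Any using (here; index)
open import Data.List.Relation.Unary.Any.Properties using (lookup-index)
open import Data.Product using (Σ; ∃; ∃-syntax; _×_; _,_; proj₁; proj₂; swap)
open import Data.Sum using (inj₁; inj₂)
open import Data.Empty using (⊥; ⊥-elim)
open import Data.Unit using (⊤; tt)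
open import Function.Base using (_∘_; const; id)
open import Function.Bundles using (_⇔_; mk⇔; Equivalence)
open import Relation.Nullary using (¬_; Dec; yes; no)
open import Relation.Nullary.Decidable
  using (map′; decidable-stable; ¬¬-excluded-middle; _×-dec_; _⊎-dec_; _→-dec_; ¬?)
open import Relation.Binary.PropositionalEquality using (_≡_; _≢_; refl; sym; trans; cong; cong₂; subst)

open Equivalence using (to; from)

-- Double negation as a monad.

infixl 1 _>>=_

_>>=_ : {A B : Set} → ¬ ¬ A → (A → ¬ ¬ B) → ¬ ¬ B
(m >>= f) k = m (λ a → f a k)

return : {A : Set} → A → ¬ ¬ A
return a k = k a

-- Finite types and their subsets.

record Finite (A : Set) : Set where
  field
    size     : ℕ
    idx      : A → Fin size
    elem     : Fin size → A
    elem∘idx : ∀ a → elem (idx a) ≡ a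

  idx-injective : ∀ {a b} → idx a ≡ idx b → a ≡ b
  idx-injective {a} {b} eq = trans (sym (elem∘idx a)) (trans (cong elem eq) (elem∘idx b))

  _≟ᶠ_ : (a b : A) → Dec (a ≡ b)
  a ≟ᶠ b = map′ idx-injective (cong idx) (idx a Fin.≟ idx b)

  any? : {P : A → Set} → (∀ a → Dec (P a)) → Dec (∃ P)
  any? {P} P? = map′ (λ { (i , p) → elem i , p })
                     (λ { (a , p) → idx a , subst P (sym (elem∘idx a)) p })
                     (Fin.any? (λ i → P? (elem i)))

  all? : {P : A → Set} → (∀ a → Dec (P a)) → Dec (∀ a → P a)
  all? {P} P? = map′ (λ f a → subst P (elem∘idx a) (f (idx a)))
                     (λ f i → f (elem i))
                     (Fin.all? (λ i → P? (elem i)))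

open Finite

¬¬-∀-Fin : ∀ {n} {Q : Fin n → Set} → (∀ i → ¬ ¬ Q i) → ¬ ¬ (∀ i → Q i)
¬¬-∀-Fin {zero}  h = return λ ()
¬¬-∀-Fin {suc n} h = do
  q  ← h zero
  qs ← ¬¬-∀-Fin (λ i → h (suc i))
  return λ { zero → q ; (suc i) → qs i }

¬¬-∀ : ∀ {A} → Finite A → {Q : A → Set} → (∀ a → ¬ ¬ Q a) → ¬ ¬ (∀ a → Q a)
¬¬-∀ F {Q} h = do
  qs ← ¬¬-∀-Fin (λ i → h (elem F i))
  return λ a → subst Q (elem∘idx F a) (qs (idx F a))

finite-⊥ : Finite ⊥
finite-⊥ = record { size = 0 ; idx = λ () ; elem = λ () ; elem∘idx = λ () }

finite-Fin : ∀ n → Finite (Fin n)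
finite-Fin n = record { size = n ; idx = id ; elem = id ; elem∘idx = λ _ → refl }

finite-× : ∀ {A B} → Finite A → Finite B → Finite (A × B)
finite-× F G = record
  { size     = size F * size G
  ; idx      = λ { (a , b) → combine (idx F a) (idx G b) }
  ; elem     = λ i → elem F (proj₁ (remQuot (size G) i)) , elem G (proj₂ (remQuot {size F} (size G) i))
  ; elem∘idx = λ { (a , b) → cong₂ _,_
      (trans (cong (elem F ∘ proj₁) (Fin.remQuot-combine (idx F a) (idx G b))) (elem∘idx F a))
      (trans (cong (elem G ∘ proj₂) (Fin.remQuot-combine (idx F a) (idx G b))) (elem∘idx G b)) }
  }

-- A subset is the number coding its characteristic function, so its finiteness needs no function
-- extensionality. The wrapper keeps `F` recoverable from the type.
record Sub {A : Set} (F : Finite A) : Set where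
  constructor mkSub
  field code : Fin (2 ^ size F)

open Sub

finite-Sub : ∀ {A} (F : Finite A) → Finite (Sub F)
finite-Sub F = record { size = 2 ^ size F ; idx = code ; elem = mkSub ; elem∘idx = λ _ → refl }

module _ {A : Set} {F : Finite A} where

  infix 4 _∈ˢ_ _∈ˢ?_

  _∈ˢ_ : A → Sub F → Set
  a ∈ˢ s = finToFun (code s) (idx F a) ≡ suc zero

  _∈ˢ?_ : ∀ a s → Dec (a ∈ˢ s)
  a ∈ˢ? s = finToFun (code s) (idx F a) Fin.≟ suc zero

  private
    bit : {P : Set} → Dec P → Fin 2
    bit (yes _) = suc zero
    bit (no _)  = zero

    bit-⇔ : {P : Set} (p : Dec P) → bit p ≡ suc zero ⇔ P
    bit-⇔ (yes p) = mk⇔ (λ _ → p) (λ _ → refl)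
    bit-⇔ (no ¬p) = mk⇔ (λ ()) (⊥-elim ∘ ¬p)

  subset : {P : A → Set} → (∀ a → Dec (P a)) → Sub F
  subset P? = mkSub (funToFin (λ i → bit (P? (elem F i))))

  ∈ˢ-subset : {P : A → Set} (P? : ∀ a → Dec (P a)) → ∀ a → a ∈ˢ subset P? ⇔ P a
  ∈ˢ-subset {P} P? a =
    subst (λ b → b ≡ suc zero ⇔ P a)
          (sym (Fin.finToFun-funToFin (λ i → bit (P? (elem F i))) (idx F a)))
          (subst (λ b → bit (P? b) ≡ suc zero ⇔ P a) (sym (elem∘idx F a)) (bit-⇔ (P? a)))

  ∅ : Sub F
  ∅ = subset {λ _ → ⊥} (λ _ → no id)

  -- `P` may be undecidable, but finitely many instances of excluded middle hold jointly under a
  -- double negation.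
  comprehension : (P : A → Set) → ¬ ¬ (Σ (Sub F) λ s → ∀ a → a ∈ˢ s ⇔ P a)
  comprehension P = do
    P? ← ¬¬-∀ F (λ a → ¬¬-excluded-middle {A = P a})
    return (subset P? , ∈ˢ-subset P?)

-- Countability by a pairing function.

double : ℕ → ℕ
double zero    = zero
double (suc n) = suc (suc (double n))

double-injective : ∀ {m n} → double m ≡ double n → m ≡ n
double-injective {zero}  {zero}  _ = refl
double-injective {suc m} {suc n} e = cong suc (double-injective (suc-injective (suc-injective e)))

odd≢even : ∀ {m n} → suc (double m) ≢ double n
odd≢even {zero}  {suc zero} ()
odd≢even {suc m} {suc n} e = odd≢even (suc-injective (suc-injective e))

-- (a , b) ↦ 2ᵃ (2b + 1)
pairing : ℕ → ℕ → ℕ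
pairing zero    b = suc (double b)
pairing (suc a) b = double (pairing a b)

pairing-injective : ∀ a a′ {b b′} → pairing a b ≡ pairing a′ b′ → a ≡ a′ × b ≡ b′
pairing-injective zero    zero     e = refl , double-injective (suc-injective e)
pairing-injective zero    (suc _)  e = ⊥-elim (odd≢even e)
pairing-injective (suc _) zero     e = ⊥-elim (odd≢even (sym e))
pairing-injective (suc a) (suc a′) e with pairing-injective a a′ (double-injective e)
... | a≡a′ , b≡b′ = cong suc a≡a′ , b≡b′

Σ-countable : {B : ℕ → Set} → (∀ n → Finite (B n)) → Countable (Σ ℕ B)
Σ-countable F = (λ { (n , b) → pairing n (toℕ (idx (F n) b)) }) , inj
  where
  inj : ∀ {x y} → _ → x ≡ y
  inj {m , b} {n , c} e with pairing-injective m n e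
  ... | refl , eq = cong (m ,_) (idx-injective (F m) (Fin.toℕ-injective eq))

Finite-countable : {A : Set} → Finite A → Countable A
Finite-countable F = toℕ ∘ idx F , idx-injective F ∘ Fin.toℕ-injective

-- Assignments to the two variables.

other : Var → Var
other vx = vy
other vy = vx

pair : {X : Set} → X → X → Var → X
pair a b vx = a
pair a b vy = b

at : {X : Set} → Var → X → X → Var → X
at vx a b = pair a b
at vy a b = pair b a

-- The type of a pair has one component for each way of assigning its members to the two variables;
-- this selects the one in which `z` takes the first member.
view : {X : Set} → Var → X × X → X
view vx = proj₁
view vy = proj₂

module _ (M : Model) where
  open Model M

  Sat-cong : ∀ φ {w σ τ} → (∀ z → Free z φ → σ z ≡ τ z) → Sat M w σ φ → Sat M w τ φ

  private
    ↦-cong : ∀ (P : Var → Set) z {d} {σ τ : Var → D} →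
             (∀ z′ → z′ ≢ z → P z′ → σ z′ ≡ τ z′) →
             ∀ z′ → P z′ → (_[_↦_] M σ z d) z′ ≡ (_[_↦_] M τ z d) z′
    ↦-cong P vx eq vx _ = refl
    ↦-cong P vx eq vy p = eq vy (λ ()) p
    ↦-cong P vy eq vx p = eq vx (λ ()) p
    ↦-cong P vy eq vy _ = refl

  Sat-cong (pos p)  eq s = s
  Sat-cong (neg p)  eq s = s
  Sat-cong (φ ∧' ψ) eq (s , t) = Sat-cong φ (λ z → eq z ∘ and-l) s , Sat-cong ψ (λ z → eq z ∘ and-r) t
  Sat-cong (φ ∨' ψ) eq (inj₁ s) = inj₁ (Sat-cong φ (λ z → eq z ∘ or-l) s)
  Sat-cong (φ ∨' ψ) eq (inj₂ t) = inj₂ (Sat-cong ψ (λ z → eq z ∘ or-r) t)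
  Sat-cong (ex z φ) eq (d , δd , s) =
    d , δd , Sat-cong φ (↦-cong (λ z′ → Free z′ φ) z (λ z′ ne fr → eq z′ (ex-in ne fr))) s
  Sat-cong (all z φ) eq s d δd =
    Sat-cong φ (↦-cong (λ z′ → Free z′ φ) z (λ z′ ne fr → eq z′ (all-in ne fr))) (s d δd)
  Sat-cong (box z φ) {w} eq s v r =
    Sat-cong φ (λ z′ → eq z′ ∘ box-in) (s v (subst (λ d → R w d v) (sym (eq z box-here)) r))
  Sat-cong (dia z φ) {w} eq (v , r , s) =
    v , subst (λ d → R w d v) (eq z dia-here) r , Sat-cong φ (λ z′ → eq z′ ∘ dia-in) s

  Sat-≗ : ∀ φ {w σ τ} → (∀ z → σ z ≡ τ z) → Sat M w σ φ → Sat M w τ φ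
  Sat-≗ φ eq = Sat-cong φ (λ z _ → eq z)

-- Modal depth, modal subformulas and propositions.

depth : Form → ℕ
depth (pos p)   = 0
depth (neg p)   = 0
depth (φ ∧' ψ)  = depth φ ⊔ depth ψ
depth (φ ∨' ψ)  = depth φ ⊔ depth ψ
depth (ex z φ)  = depth φ
depth (all z φ) = depth φ
depth (box z φ) = suc (depth φ)
depth (dia z φ) = suc (depth φ)

modules : Form → List Form
modules (pos p)   = []
modules (neg p)   = []
modules (φ ∧' ψ)  = modules φ ++ modules ψ
modules (φ ∨' ψ)  = modules φ ++ modules ψ
modules (ex z φ)  = modules φ
modules (all z φ) = modules φ
modules (box z φ) = box z φ ∷ modules φ
modules (dia z φ) = dia z φ ∷ modules φ

props : Form → List ℕ
props (pos p)   = p ∷ []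
props (neg p)   = p ∷ []
props (φ ∧' ψ)  = props φ ++ props ψ
props (φ ∨' ψ)  = props φ ++ props ψ
props (ex z φ)  = props φ
props (all z φ) = props φ
props (box z φ) = props φ
props (dia z φ) = props φ

-- Phases and their cyclic order.

data Direction : Set where
  forward backward none : Direction

flip : Direction → Direction
flip forward  = backward
flip backward = forward
flip none     = none

-- The agents inherited from earlier worlds act as a fourth phase, preceding p₀.
data Phase : Set where
  inherited p₀ p₁ p₂ : Phase

phase : Fin 3 → Phase
phase zero             = p₀
phase (suc zero)       = p₁
phase (suc (suc zero)) = p₂

successor : Phase → Fin 3
successor inherited = zero
successor p₀ = suc zero
successor p₁ = suc (suc zero)
successor p₂ = zero

-- `forward` lets the second agent prescribe the type of the pair, `backward` the first. In a cycle
-- of three no two phases succeed each other, so the two never compete; inherited agents prescribe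
-- nothing.
direction : Phase → Phase → Direction
direction inherited p₀ = forward
direction p₀ p₁ = forward
direction p₁ p₂ = forward
direction p₂ p₀ = forward
direction p₀ inherited = backward
direction p₁ p₀ = backward
direction p₂ p₁ = backward
direction p₀ p₂ = backward
direction _ _ = none

direction-flip : ∀ p q → direction q p ≡ flip (direction p q)
direction-flip inherited inherited = refl
direction-flip inherited p₀ = refl
direction-flip inherited p₁ = refl
direction-flip inherited p₂ = refl
direction-flip p₀ inherited = refl
direction-flip p₀ p₀ = refl
direction-flip p₀ p₁ = refl
direction-flip p₀ p₂ = refl
direction-flip p₁ inherited = refl
direction-flip p₁ p₀ = refl
direction-flip p₁ p₁ = refl
direction-flip p₁ p₂ = refl
direction-flip p₂ inherited = refl
direction-flip p₂ p₀ = refl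
direction-flip p₂ p₁ = refl
direction-flip p₂ p₂ = refl

direction-self : ∀ p → direction p p ≡ none
direction-self inherited = refl
direction-self p₀ = refl
direction-self p₁ = refl
direction-self p₂ = refl

direction-successor : ∀ p → direction p (phase (successor p)) ≡ forward
direction-successor inherited = refl
direction-successor p₀ = refl
direction-successor p₁ = refl
direction-successor p₂ = refl

-- Finite tree models with decidable satisfaction.

module TreeModel (Φ : List Form) (Ps : List ℕ) (N : ℕ) where

  Bits : Set
  Bits = Sub (finite-Fin (length Φ))

  Type : Set
  Type = Bits × Bits

  finite-Type : Finite Type
  finite-Type = finite-× (finite-Sub _) (finite-Sub _)

  Star : Set
  Star = Sub finite-Type

  finite-Star : Finite Star
  finite-Star = finite-Sub _

  -- The first component is zero, or one more than the height, from 0 to `N`, at which the agent is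
  -- introduced. The others are the star it represents, the type it should realise and its phase.
  Agent : Set
  Agent = Fin (suc (suc N)) × (Star × Type × Fin 3)

  finite-Agent : Finite Agent
  finite-Agent = finite-× (finite-Fin _) (finite-× finite-Star (finite-× finite-Type (finite-Fin _)))

  root : Agent
  root = zero , ∅ , (∅ , ∅) , zero

  Val : Set
  Val = Sub (finite-Fin (length Ps))

  -- A world of height `n` is an element of `Tree (suc n)`, and leaves have no children because
  -- `Tree zero` is empty. A world is nothing but its valuation and its labelled children, so each
  -- height has finitely many worlds.
  Tree : ℕ → Set
  finite-Tree : ∀ n → Finite (Tree n)

  Tree zero    = ⊥
  Tree (suc n) = Val × Sub (finite-× finite-Agent (finite-Tree n))

  finite-Tree zero    = finite-⊥
  finite-Tree (suc n) = finite-× (finite-Sub _) (finite-Sub _)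

  World : Set
  World = Σ ℕ (Tree ∘ suc)

  -- A world of height n contains the agents introduced at heights ≥ n; those with first
  -- component zero belong to every world.
  Present : ℕ → Agent → Set
  Present n (zero  , _) = ⊤
  Present n (suc l , _) = n ≤ toℕ l

  present? : ∀ n a → Dec (Present n a)
  present? n (zero  , _) = yes tt
  present? n (suc l , _) = n ≤? toℕ l

  Present-pred : ∀ {n} a → Present (suc n) a → Present n a
  Present-pred (zero  , _) p = tt
  Present-pred (suc l , _) p = ≤-trans (n≤1+n _) p

  data Step : World → Agent → World → Set where
    step : ∀ {n ps cs a u} → Present (suc n) a → (a , u) ∈ˢ cs → Step (suc n , ps , cs) a (n , u)

  step? : ∀ {P : World → Set} w a → (∀ v → Dec (P v)) → Dec (∃ λ v → Step w a v × P v)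
  step? (zero  , _)       a P? = no λ { (_ , () , _) }
  step? (suc n , ps , cs) a P? =
    map′ (λ { (u , (pr , m) , p) → (n , u) , step pr m , p })
         (λ { ((_ , u) , step pr m , p) → u , (pr , m) , p })
         (any? (finite-Tree (suc n)) (λ u → (present? (suc n) a ×-dec ((a , u) ∈ˢ? cs)) ×-dec P? (n , u)))

  treeModel : Model
  treeModel = record
    { W = World
    ; D = Agent
    ; δ = λ w → Present (proj₁ w)
    ; R = Step
    ; ρ = λ w p → ∃[ i ] (i ∈ˢ proj₁ (proj₂ w) × lookup Ps i ≡ p)
    ; W-countable = Σ-countable (finite-Tree ∘ suc)
    ; D-countable = Finite-countable finite-Agent
    ; W-nonempty  = 0 , ∅ , ∅
    ; D-nonempty  = root
    ; δ-nonempty  = λ _ → root , tt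
    ; R-agent     = λ { (step pr _) → pr }
    ; R-mono      = λ { (step _ _) {a} → Present-pred a }
    }

  infix 4 _⊩_⟨_⟩

  _⊩_⟨_⟩ : World → Form → (Var → Agent) → Set
  w ⊩ φ ⟨ σ ⟩ = Sat treeModel w σ φ

  ⊩? : ∀ φ w σ → Dec (w ⊩ φ ⟨ σ ⟩)
  val? : ∀ (w : World) p → Dec (Model.ρ treeModel w p)
  val? w p = any? (finite-Fin _) (λ i → (i ∈ˢ? proj₁ (proj₂ w)) ×-dec (lookup Ps i ≟ p))

  ⊩? (pos p)   w σ = val? w p
  ⊩? (neg p)   w σ = ¬? (val? w p)
  ⊩? (φ ∧' ψ)  w σ = ⊩? φ w σ ×-dec ⊩? ψ w σ
  ⊩? (φ ∨' ψ)  w σ = ⊩? φ w σ ⊎-dec ⊩? ψ w σ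
  ⊩? (ex z φ)  w σ = any? finite-Agent (λ a → present? (proj₁ w) a ×-dec ⊩? φ w _)
  ⊩? (all z φ) w σ = all? finite-Agent (λ a → present? (proj₁ w) a →-dec ⊩? φ w _)
  ⊩? (dia z φ) w σ = step? w (σ z) (λ v → ⊩? φ v σ)
  ⊩? (box z φ) w σ =
    map′ (λ no-bad v r → decidable-stable (⊩? φ v σ) (λ ¬s → no-bad (v , r , ¬s)))
         (λ s → λ { (v , r , ¬s) → ¬s (s v r) })
         (¬? (step? w (σ z) (λ v → ¬? (⊩? φ v σ))))

  -- `Φ` and `Ps` stay fixed while the induction descends into subformulas; this is the invariant
  -- that ties the subformulas to them.
  Covered : Form → Set
  Covered (pos p)   = p ∈ Ps
  Covered (neg p)   = p ∈ Ps
  Covered (φ ∧' ψ)  = Covered φ × Covered ψ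
  Covered (φ ∨' ψ)  = Covered φ × Covered ψ
  Covered (ex z φ)  = Covered φ
  Covered (all z φ) = Covered φ
  Covered (box z φ) = box z φ ∈ Φ × Covered φ
  Covered (dia z φ) = dia z φ ∈ Φ × Covered φ

  covered : ∀ φ → modules φ ⊆ Φ → props φ ⊆ Ps → Covered φ
  covered (pos p)   m⊆ p⊆ = p⊆ (here refl)
  covered (neg p)   m⊆ p⊆ = p⊆ (here refl)
  covered (φ ∧' ψ)  m⊆ p⊆ =
    covered φ (m⊆ ∘ xs⊆xs++ys _ _) (p⊆ ∘ xs⊆xs++ys _ _) ,
    covered ψ (m⊆ ∘ xs⊆ys++xs _ (modules φ)) (p⊆ ∘ xs⊆ys++xs _ (props φ))
  covered (φ ∨' ψ)  m⊆ p⊆ =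
    covered φ (m⊆ ∘ xs⊆xs++ys _ _) (p⊆ ∘ xs⊆xs++ys _ _) ,
    covered ψ (m⊆ ∘ xs⊆ys++xs _ (modules φ)) (p⊆ ∘ xs⊆ys++xs _ (props φ))
  covered (ex z φ)  m⊆ p⊆ = covered φ m⊆ p⊆
  covered (all z φ) m⊆ p⊆ = covered φ m⊆ p⊆
  covered (box z φ) m⊆ p⊆ = m⊆ (here refl) , covered φ (m⊆ ∘ xs⊆x∷xs _ _) p⊆
  covered (dia z φ) m⊆ p⊆ = m⊆ (here refl) , covered φ (m⊆ ∘ xs⊆x∷xs _ _) p⊆

  Fresh : ℕ → Agent → Set
  Fresh n (zero  , _) = ⊥
  Fresh n (suc l , _) = toℕ l ≡ n

  fresh? : ∀ n a → Dec (Fresh n a)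
  fresh? n (zero  , _) = no id
  fresh? n (suc l , _) = toℕ l ≟ n

  Present⇒¬Fresh : ∀ {n} a → Present (suc n) a → ¬ Fresh n a
  Present⇒¬Fresh (suc l , _) p refl = 1+n≰n p

  -- Types and stars in the given model.

  module Transfer (M : Model) where
    open Model M

    HasBits : W → (Var → D) → Bits → Set
    HasBits w τ v = ∀ i → i ∈ˢ v ⇔ Sat M w τ (lookup Φ i)

    HasType : W → D → D → Type → Set
    HasType w d e (s , t) = HasBits w (pair d e) s × HasBits w (pair e d) t

    HasStar : W → D → Star → Set
    HasStar w d s = ∀ t → t ∈ˢ s ⇔ (∃[ e ] (δ w e × HasType w d e t))

    HasType-view : ∀ z {w d e t} → HasType w d e t → HasBits w (at z d e) (view z t)
    HasType-view vx = proj₁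
    HasType-view vy = proj₂

    HasBits-≗ : ∀ {w τ τ′ v} → (∀ z → τ z ≡ τ′ z) → HasBits w τ v → HasBits w τ′ v
    HasBits-≗ {w} eq h i = mk⇔ (Sat-≗ M (lookup Φ i) {w} eq ∘ to (h i))
                               (from (h i) ∘ Sat-≗ M (lookup Φ i) {w} (sym ∘ eq))

    -- Truth passes in one direction only, as formulas are in negation normal form. `σ` avoids the
    -- agents fresh at height `n`, since the map will be redefined on them.
    Preserves : ∀ n → Tree n → W → (Agent → D) → Set
    Preserves (suc n) u w f =
      ∀ φ → FSNFDNF φ → Covered φ → depth φ ≤ n →
      ∀ σ → (∀ z → Present (suc n) (σ z)) → Sat M w (f ∘ σ) φ → (n , u) ⊩ φ ⟨ σ ⟩

    -- `type a b` need not be the type of `(g a , g b)`. It only has to occur at `g a`, and its swap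
    -- at `g b`: a successor along `a` may move `b` but never `a`, which is why `type-real` fixes
    -- the diagonal.
    record Extension (n : ℕ) (w : W) (f : Agent → D) : Set where
      field
        g           : Agent → D
        g∈δ         : ∀ a → δ w (g a)
        g-old       : ∀ a → Present (suc n) a → g a ≡ f a
        type        : Agent → Agent → Type
        type-swap   : ∀ a b → type b a ≡ swap (type a b)
        type-real   : ∀ a b → ∃[ e ] (δ w e × HasType w (g a) e (type a b) × (b ≡ a → e ≡ g a))
        type-old    : ∀ a b → Present (suc n) a → Present (suc n) b → HasType w (g a) (g b) (type a b)
        witness     : ∀ a e → δ w e → ¬ ¬ (∃[ b ] (Present n b × HasType w (g a) e (type a b)))

    -- Fresh agents and the types prescribed for pairs.

    module Construct {n w} (n≤N : n ≤ N) (f : Agent → D) (f∈δ : ∀ a → δ w (f a)) where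

      Representative : Star → D → Set
      Representative s d = δ w d × (∀ e → δ w e → HasStar w e s → HasStar w d s)

      ∃-representative : ∀ s → ¬ ¬ (∃ (Representative s))
      ∃-representative s = do
        yes (d , d∈δ , h) ← ¬¬-excluded-middle {A = ∃[ d ] (δ w d × HasStar w d s)}
          -- No agent of `w` has star `s`, so an arbitrary element of the domain serves.
          where no ¬∃ → return (f root , f∈δ root , λ e e∈δ h → ⊥-elim (¬∃ (e , e∈δ , h)))
        return (d , d∈δ , λ _ _ _ → h)

      module _ (rep : ∀ s → ∃ (Representative s)) where

        pick : ∀ a → Dec (Fresh n a) → D
        pick (_ , s , _) (yes _) = proj₁ (rep s)
        pick a           (no _)  = f a

        g : Agent → D
        g a = pick a (fresh? n a)

        g∈δ : ∀ a → δ w (g a)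
        g∈δ a with fresh? n a
        ... | yes _ = proj₁ (proj₂ (rep _))
        ... | no _  = f∈δ a

        g-old : ∀ a → Present (suc n) a → g a ≡ f a
        g-old a p with fresh? n a
        ... | yes fr = ⊥-elim (Present⇒¬Fresh a p fr)
        ... | no _   = refl

        phaseOf : Agent → Phase
        phaseOf a@(_ , _ , _ , i) with fresh? n a
        ... | yes _ = phase i
        ... | no _  = inherited

        phase-old : ∀ a → Present (suc n) a → phaseOf a ≡ inherited
        phase-old a p with fresh? n a
        ... | yes fr = ⊥-elim (Present⇒¬Fresh a p fr)
        ... | no _   = refl

        module _ (star : ∀ a → ∃ (HasStar w (g a)))
                 (bits : ∀ a b → ∃ (HasBits w (pair (g a) (g b)))) where

          default : Agent → Agent → Type
          default a b = proj₁ (bits a b) , proj₁ (bits b a)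

          default-HasType : ∀ a b → HasType w (g a) (g b) (default a b)
          default-HasType a b = proj₂ (bits a b) , proj₂ (bits b a)

          wanted : Agent → Type
          wanted (_ , _ , t , _) = t

          -- Both ends of the pair must be able to realise the type, because `type-real` is needed
          -- for `(a , b)` and for `(b , a)`.
          Admissible : Agent → Agent → Set
          Admissible a b = wanted b ∈ˢ proj₁ (star a) × swap (wanted b) ∈ˢ proj₁ (star b)

          admissible? : ∀ a b → Dec (Admissible a b)
          admissible? a b = (wanted b ∈ˢ? proj₁ (star a)) ×-dec (swap (wanted b) ∈ˢ? proj₁ (star b))

          attempt : Agent → Agent → Type
          attempt a b with admissible? a b
          ... | yes _ = wanted b
          ... | no _  = default a b

          resolve : Direction → Agent → Agent → Type
          resolve forward  a b = attempt a b
          resolve backward a b = swap (attempt b a)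
          resolve none     a b = default a b

          resolve-flip : ∀ d a b → resolve (flip d) b a ≡ swap (resolve d a b)
          resolve-flip forward  a b = refl
          resolve-flip backward a b = refl
          resolve-flip none     a b = refl

          resolve-real : ∀ d a b → ∃[ e ] (δ w e × HasType w (g a) e (resolve d a b))
          resolve-real forward a b with admissible? a b
          ... | yes (t∈ , _) = to (proj₂ (star a) _) t∈
          ... | no _         = g b , g∈δ b , default-HasType a b
          resolve-real backward a b with admissible? b a
          ... | yes (_ , t∈) = to (proj₂ (star a) _) t∈
          ... | no _         = g b , g∈δ b , default-HasType a b
          resolve-real none a b = g b , g∈δ b , default-HasType a b

          type : Agent → Agent → Type
          type a b = resolve (direction (phaseOf a) (phaseOf b)) a b

          type-swap : ∀ a b → type b a ≡ swap (type a b)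
          type-swap a b rewrite direction-flip (phaseOf a) (phaseOf b) =
            resolve-flip (direction (phaseOf a) (phaseOf b)) a b

          type-real : ∀ a b → ∃[ e ] (δ w e × HasType w (g a) e (type a b) × (b ≡ a → e ≡ g a))
          type-real a b with _≟ᶠ_ finite-Agent b a
          -- An agent shares its own phase, so its type with itself is the actual one and `g a`
          -- realises it.
          ... | yes refl rewrite direction-self (phaseOf a) = g a , g∈δ a , default-HasType a a , const refl
          ... | no b≢a with resolve-real (direction (phaseOf a) (phaseOf b)) a b
          ...   | e , e∈δ , h = e , e∈δ , h , ⊥-elim ∘ b≢a

          type-old : ∀ a b → Present (suc n) a → Present (suc n) b → HasType w (g a) (g b) (type a b)
          type-old a b pa pb rewrite phase-old a pa | phase-old b pb = default-HasType a b

          newcomer : Star → Type → Fin 3 → Agent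
          newcomer s t i = suc (fromℕ< (s≤s n≤N)) , s , t , i

          newcomer-level : ∀ s t i → Fresh n (newcomer s t i)
          newcomer-level s t i = Fin.toℕ-fromℕ< (s≤s n≤N)

          newcomer-star : ∀ s t i e → δ w e → HasStar w e s → HasStar w (g (newcomer s t i)) s
          newcomer-star s t i e e∈δ h with fresh? n (newcomer s t i)
          ... | yes _  = proj₂ (proj₂ (rep s)) e e∈δ h
          ... | no ¬fr = ⊥-elim (¬fr (newcomer-level s t i))

          newcomer-phase : ∀ s t i → phaseOf (newcomer s t i) ≡ phase i
          newcomer-phase s t i with fresh? n (newcomer s t i)
          ... | yes _  = refl
          ... | no ¬fr = ⊥-elim (¬fr (newcomer-level s t i))

          attempt-admissible : ∀ a b → Admissible a b → attempt a b ≡ wanted b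
          attempt-admissible a b adm with admissible? a b
          ... | yes _   = refl
          ... | no ¬adm = ⊥-elim (¬adm adm)

          -- Let `t` be the type of `(g a , e)` and `s` the star of `e`. The fresh agent for `s` and
          -- `t` in the phase after that of `a` is admissible: `e` puts `t` into the star of `a`,
          -- and the representative of `s` has the same star as `e`, which contains the swap of `t`
          -- because of `g a`.
          witness : ∀ a e → δ w e → ¬ ¬ (∃[ b ] (Present n b × HasType w (g a) e (type a b)))
          witness a e e∈δ = do
            s₁ , h₁ ← comprehension _
            s₂ , h₂ ← comprehension _
            s  , h  ← comprehension _
            let t : Type
                t = s₁ , s₂
                b = newcomer s t (successor (phaseOf a))
                adm : Admissible a b
                adm = from (proj₂ (star a) t) (e , e∈δ , h₁ , h₂)
                    , from (proj₂ (star b) (swap t))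
                        (to (newcomer-star s t _ e e∈δ h (swap t))
                          (from (h (swap t)) (g a , g∈δ a , h₂ , h₁)))
                type≡t : type a b ≡ t
                type≡t = trans (cong (λ p → resolve (direction (phaseOf a) p) a b) (newcomer-phase s t _))
                           (trans (cong (λ d → resolve d a b) (direction-successor (phaseOf a)))
                             (attempt-admissible a b adm))
            return (b , ≤-reflexive (sym (newcomer-level s t (successor (phaseOf a))))
                      , subst (HasType w (g a) e) (sym type≡t) (h₁ , h₂))

          extend : Extension n w f
          extend = record
            { g = g ; g∈δ = g∈δ ; g-old = g-old
            ; type = type ; type-swap = type-swap ; type-real = type-real ; type-old = type-old
            ; witness = witness }

      extension : ¬ ¬ Extension n w f
      extension = do
        rep  ← ¬¬-∀ finite-Star ∃-representative
        star ← ¬¬-∀ finite-Agent (λ a → comprehension _)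
        bits ← ¬¬-∀ finite-Agent (λ a → ¬¬-∀ finite-Agent (λ b → comprehension _))
        return (extend rep star bits)

    -- The imitating world and its children.

    open Construct using (extension)

    open Extension

    -- Every tree that imitates a suitable successor becomes a child. Boxes then hold because
    -- children carry the required data, and diamonds need only one such tree to exist.
    Child : ∀ {n w f} → Extension n w f → Agent × Tree n → Set
    Child {n} {w} E (a , u) =
      ∃[ v ] (R w (g E a) v ×
      ∃[ h ] ((∀ b → HasType w (g E a) (h b) (type E a b)) × h a ≡ g E a × Preserves n u v h))

    record Node {n w f} (E : Extension n w f) : Set where
      field
        val        : Val
        val-⇔      : ∀ i → i ∈ˢ val ⇔ ρ w (lookup Ps i)
        children   : Sub (finite-× finite-Agent (finite-Tree n))
        children-⇔ : ∀ c → c ∈ˢ children ⇔ Child E c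

      world : World
      world = n , val , children

    open Node

    node : ∀ {n w f} (E : Extension n w f) → ¬ ¬ Node E
    node E = do
      vs , vs⇔ ← comprehension _
      cs , cs⇔ ← comprehension (Child E)
      return (record { val = vs ; val-⇔ = vs⇔ ; children = cs ; children-⇔ = cs⇔ })

    -- Transfer of satisfaction to the imitating world.

    AllPresent : ℕ → (Var → Agent) → Set
    AllPresent n σ = ∀ z → Present n (σ z)

    typeOf : ∀ {n w f} → Extension n w f → (Var → Agent) → Bits
    typeOf E σ = proj₁ (type E (σ vx) (σ vy))

    typeOf-view : ∀ {n w f} (E : Extension n w f) σ z → typeOf E σ ≡ view z (type E (σ z) (σ (other z)))
    typeOf-view E σ vx = refl
    typeOf-view E σ vy = cong proj₁ (type-swap E (σ vy) (σ vx))

    at-map : ∀ z {h : Agent → D} {σ : Var → Agent} {d} → h (σ z) ≡ d →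
             ∀ z′ → at z d (h (σ (other z))) z′ ≡ h (σ z′)
    at-map vx eq vx = sym eq
    at-map vx eq vy = refl
    at-map vy eq vx = refl
    at-map vy eq vy = sym eq

    -- `h` keeps the image of `σ z` and sends the value of the other variable to an agent forming
    -- the prescribed type with it. So the bits prescribed for `σ` are the actual ones at `w` under
    -- `h ∘ σ`.
    child-bits : ∀ {n w f} (E : Extension n w f) σ z {h} →
                 (∀ b → HasType w (g E (σ z)) (h b) (type E (σ z) b)) → h (σ z) ≡ g E (σ z) →
                 HasBits w (h ∘ σ) (typeOf E σ)
    child-bits E σ z {h} ht eq =
      HasBits-≗ (at-map z {h} {σ} eq)
        (subst (HasBits _ _) (sym (typeOf-view E σ z)) (HasType-view z (ht (σ (other z)))))

    box-transfer : ∀ {n w f} (E : Extension n w f) (X : Node E) z {α i} → lookup Φ i ≡ box z α →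
                   FSNFDNF α → Covered α → depth (box z α) ≤ n → ∀ σ → AllPresent n σ →
                   i ∈ˢ typeOf E σ → world X ⊩ box z α ⟨ σ ⟩
    box-transfer {w = w} E X z {α} {i} eq nf cov (s≤s d≤) σ pσ i∈ _ (step _ c∈)
      with to (children-⇔ X _) c∈
    ... | v , r , h , ht , h≡g , pres =
      pres α nf cov d≤ σ pσ
        (subst (Sat M w (h ∘ σ)) eq (to (child-bits E σ z ht h≡g i) i∈)
          v (subst (λ d → R w d v) (sym h≡g) r))

    Realisable : ℕ → Set
    Realisable n = ∀ v h → (∀ a → δ v (h a)) → ¬ ¬ (∃[ u ] Preserves n u v h)

    -- Moving every agent to a realiser given by `type-real` makes the prescribed diamond true at
    -- `w`. Its successor `v` is imitated by induction, and the moved agents stay in the domain of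
    -- `v` by monotonicity. The depth bound excludes leaves.
    dia-transfer : ∀ {n w f} (E : Extension n w f) (X : Node E) → (1 ≤ n → Realisable n) →
                   ∀ z {β i} → lookup Φ i ≡ dia z β →
                   FSNFDNF β → Covered β → depth (dia z β) ≤ n → ∀ σ → AllPresent n σ →
                   i ∈ˢ typeOf E σ → ¬ ¬ (world X ⊩ dia z β ⟨ σ ⟩)
    dia-transfer {suc n} {w} E X ih z {β} {i} eq nf cov (s≤s d≤) σ pσ i∈ =
      ih (s≤s z≤n) v h (λ a → R-mono r (h∈δ a)) >>= λ (u , pres) →
      return ((n , u) , step (pσ z) (from (children-⇔ X (σ z , u)) (v , rg , h , ht , h≡g , pres)) ,
              pres β nf cov d≤ σ pσ sat)
      where
      h : Agent → D
      h b = proj₁ (type-real E (σ z) b)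

      h∈δ : ∀ b → δ w (h b)
      h∈δ b = proj₁ (proj₂ (type-real E (σ z) b))

      ht : ∀ b → HasType w (g E (σ z)) (h b) (type E (σ z) b)
      ht b = proj₁ (proj₂ (proj₂ (type-real E (σ z) b)))

      h≡g : h (σ z) ≡ g E (σ z)
      h≡g = proj₂ (proj₂ (proj₂ (type-real E (σ z) (σ z)))) refl

      successor-world : Sat M w (h ∘ σ) (dia z β)
      successor-world = subst (Sat M w (h ∘ σ)) eq (to (child-bits E σ z ht h≡g i) i∈)

      v : W
      v = proj₁ successor-world

      r : R w (h (σ z)) v
      r = proj₁ (proj₂ successor-world)

      rg : R w (g E (σ z)) v
      rg = subst (λ d → R w d v) h≡g r

      sat : Sat M v (h ∘ σ) β
      sat = proj₂ (proj₂ successor-world)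

    module _ {n w f} (E : Extension n w f) (X : Node E) (ih : 1 ≤ n → Realisable n) where

      val-sound : ∀ {p} → p ∈ Ps → ρ w p → Model.ρ treeModel (world X) p
      val-sound p∈ ρp = index p∈ , from (val-⇔ X _) (subst (ρ w) (lookup-index p∈) ρp) , sym (lookup-index p∈)

      val-complete : ∀ {p} → Model.ρ treeModel (world X) p → ρ w p
      val-complete (i , i∈ , eq) = subst (ρ w) eq (to (val-⇔ X i) i∈)

      -- Outside its modal subformulas a quantifier-safe formula has only literals, so `τ` need not
      -- be `g E ∘ σ`; realising the type prescribed for `σ` is enough.
      safe-transfer : ∀ φ → QSNormal φ → Covered φ → depth φ ≤ n → ∀ σ τ → AllPresent n σ →
                      HasBits w τ (typeOf E σ) → Sat M w τ φ → world X ⊩ φ ⟨ σ ⟩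
      safe-transfer (pos p) _ cov _ σ τ _ _ s = val-sound cov s
      safe-transfer (neg p) _ cov _ σ τ _ _ s = s ∘ val-complete
      safe-transfer (φ ∧' ψ) (qsn ok) (cφ , cψ) d≤ σ τ pσ hb (s , t) =
        safe-transfer φ (qsn λ χ → ok χ ∘ c-and-l) cφ (m⊔n≤o⇒m≤o _ _ d≤) σ τ pσ hb s ,
        safe-transfer ψ (qsn λ χ → ok χ ∘ c-and-r) cψ (m⊔n≤o⇒n≤o (depth φ) _ d≤) σ τ pσ hb t
      safe-transfer (φ ∨' ψ) (qsn ok) (cφ , cψ) d≤ σ τ pσ hb (inj₁ s) =
        inj₁ (safe-transfer φ (qsn λ χ → ok χ ∘ c-or-l) cφ (m⊔n≤o⇒m≤o _ _ d≤) σ τ pσ hb s)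
      safe-transfer (φ ∨' ψ) (qsn ok) (cφ , cψ) d≤ σ τ pσ hb (inj₂ t) =
        inj₂ (safe-transfer ψ (qsn λ χ → ok χ ∘ c-or-r) cψ (m⊔n≤o⇒n≤o (depth φ) _ d≤) σ τ pσ hb t)
      safe-transfer (ex z φ)  (qsn ok) with ok _ c-ex
      ... | ()
      safe-transfer (all z φ) (qsn ok) with ok _ c-all
      ... | ()
      safe-transfer (box z α) (qsn ok) (m , cα) d≤ σ τ pσ hb s with ok _ c-box
      ... | m-box nf = box-transfer E X z (sym (lookup-index m)) nf cα d≤ σ pσ
                         (from (hb _) (subst (Sat M w τ) (lookup-index m) s))
      safe-transfer (dia z β) (qsn ok) (m , cβ) d≤ σ τ pσ hb s with ok _ c-dia
      ... | m-dia nf = decidable-stable (⊩? (dia z β) _ σ)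
                         (dia-transfer E X ih z (sym (lookup-index m)) nf cβ d≤ σ pσ
                           (from (hb _) (subst (Sat M w τ) (lookup-index m) s)))

      ↦-present : ∀ z {σ a} → AllPresent n σ → Present n a → AllPresent n (_[_↦_] treeModel σ z a)
      ↦-present vx pσ pa vx = pa
      ↦-present vx pσ pa vy = pσ vy
      ↦-present vy pσ pa vx = pσ vx
      ↦-present vy pσ pa vy = pa

      ↦-bits : ∀ z {σ τ b e} → τ (other z) ≡ g E (σ (other z)) →
               HasType w (g E (σ (other z))) e (type E (σ (other z)) b) →
               HasBits w (_[_↦_] M τ z e) (typeOf E (_[_↦_] treeModel σ z b))
      ↦-bits vx {σ} {τ} {b} eq (_ , hb) =
        HasBits-≗ (λ { vx → refl ; vy → sym eq })
          (subst (HasBits w _) (cong proj₁ (sym (type-swap E (σ vy) b))) hb)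
      ↦-bits vy eq (hb , _) = HasBits-≗ (λ { vx → sym eq ; vy → refl }) hb

      -- For an agent `b` of the imitation the hypothesis is instantiated not with `g E b` but with
      -- the agent realising the type prescribed for `b`. The old value of `z` is overwritten, so
      -- `τ` is constrained at the other variable only.
      all-transfer : ∀ z γ → QSNormal γ → Covered γ → depth γ ≤ n → ∀ σ τ → AllPresent n σ →
                     τ (other z) ≡ g E (σ (other z)) → Sat M w τ (all z γ) → world X ⊩ all z γ ⟨ σ ⟩
      all-transfer z γ nf cov d≤ σ τ pσ eq s b pb with type-real E (σ (other z)) b
      ... | e , e∈δ , ht , _ =
        safe-transfer γ nf cov d≤ _ _ (↦-present z pσ pb) (↦-bits z {τ = τ} eq ht) (s e e∈δ)

      -- `witness` turns an agent `e` of the given model into a present agent whose prescribed type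
      -- is the one formed by `e`.
      ex-transfer : ∀ z γ → QSNormal γ → Covered γ → depth γ ≤ n → ∀ σ τ → AllPresent n σ →
                    τ (other z) ≡ g E (σ (other z)) → Sat M w τ (ex z γ) → world X ⊩ ex z γ ⟨ σ ⟩
      ex-transfer z γ nf cov d≤ σ τ pσ eq (e , e∈δ , s) = decidable-stable (⊩? (ex z γ) _ σ) do
        b , pb , ht ← witness E (σ (other z)) e e∈δ
        return (b , pb , safe-transfer γ nf cov d≤ _ _ (↦-present z pσ pb) (↦-bits z {τ = τ} eq ht) s)

      conjunct-transfer : ∀ φ → ConjOK φ → Covered φ → depth φ ≤ n → ∀ σ → AllPresent (suc n) σ →
                          Sat M w (f ∘ σ) φ → world X ⊩ φ ⟨ σ ⟩
      conjunct-transfer φ ok cov d≤ σ pσ s = go ok cov d≤ (Sat-≗ M φ f≗g s)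
        where
        f≗g : ∀ z → f (σ z) ≡ g E (σ z)
        f≗g z = sym (g-old E (σ z) (pσ z))

        pσ′ : AllPresent n σ
        pσ′ z = Present-pred (σ z) (pσ z)

        τ : Var → D
        τ = g E ∘ σ

        τ-bits : HasBits w τ (typeOf E σ)
        -- Both values of `σ` are inherited, and between inherited agents the prescribed type is the
        -- actual one.
        τ-bits = HasBits-≗ (λ { vx → refl ; vy → refl }) (proj₁ (type-old E (σ vx) (σ vy) (pσ vx) (pσ vy)))

        safe : ∀ χ → QSNormal χ → Covered χ → depth χ ≤ n → Sat M w τ χ → world X ⊩ χ ⟨ σ ⟩
        safe χ nf c d = safe-transfer χ nf c d σ τ pσ′ τ-bits

        go : ∀ {χ} → ConjOK χ → Covered χ → depth χ ≤ n → Sat M w τ χ → world X ⊩ χ ⟨ σ ⟩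
        go {χ} k-pos      = safe χ (qsn λ { _ c-pos → m-pos })
        go {χ} k-neg      = safe χ (qsn λ { _ c-neg → m-neg })
        go {χ} (k-box nf) = safe χ (qsn λ { _ c-box → m-box nf })
        go {χ} (k-dia nf) = safe χ (qsn λ { _ c-dia → m-dia nf })
        go (k-all {z} nf) c d = all-transfer z _ nf c d σ τ pσ′ refl
        go (k-ex {z} nf)  c d = ex-transfer z _ nf c d σ τ pσ′ refl
        -- The outer quantifier is instantiated with `g E a`, where `a` may be fresh; only the inner
        -- one uses prescribed types.
        go (k-allall nf) c d s a pa = all-transfer vy _ nf c d _ _ (↦-present vx pσ′ pa) refl (s (g E a) (g∈δ E a))
        go (k-allex nf)  c d s a pa = ex-transfer vy _ nf c d _ _ (↦-present vx pσ′ pa) refl (s (g E a) (g∈δ E a))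

      conjunction-transfer : ∀ φ → All ConjOK (conjuncts φ) → Covered φ → depth φ ≤ n → ∀ σ →
                             AllPresent (suc n) σ → Sat M w (f ∘ σ) φ → world X ⊩ φ ⟨ σ ⟩
      conjunction-transfer (φ ∧' ψ) oks (cφ , cψ) d≤ σ pσ (s , t) =
        conjunction-transfer φ (++⁻ˡ (conjuncts φ) oks) cφ (m⊔n≤o⇒m≤o _ _ d≤) σ pσ s ,
        conjunction-transfer ψ (++⁻ʳ (conjuncts φ) oks) cψ (m⊔n≤o⇒n≤o (depth φ) _ d≤) σ pσ t
      conjunction-transfer (pos p)   (ok ∷ []) = conjunct-transfer _ ok
      conjunction-transfer (neg p)   (ok ∷ []) = conjunct-transfer _ ok
      conjunction-transfer (_ ∨' _)  (() ∷ [])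
      conjunction-transfer (ex z φ)  (ok ∷ []) = conjunct-transfer _ ok
      conjunction-transfer (all z φ) (ok ∷ []) = conjunct-transfer _ ok
      conjunction-transfer (box z φ) (ok ∷ []) = conjunct-transfer _ ok
      conjunction-transfer (dia z φ) (ok ∷ []) = conjunct-transfer _ ok

      fsnfConj-transfer : ∀ φ → FSNFConj φ → Covered φ → depth φ ≤ n → ∀ σ →
                          AllPresent (suc n) σ → Sat M w (f ∘ σ) φ → world X ⊩ φ ⟨ σ ⟩
      fsnfConj-transfer φ (fsnf-conj oks _ _ _ _ _) = conjunction-transfer φ oks

      disjunction-transfer : ∀ φ → All FSNFConj (disjuncts φ) → Covered φ → depth φ ≤ n → ∀ σ →
                             AllPresent (suc n) σ → Sat M w (f ∘ σ) φ → world X ⊩ φ ⟨ σ ⟩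
      disjunction-transfer (φ ∨' ψ) nfs (cφ , cψ) d≤ σ pσ (inj₁ s) =
        inj₁ (disjunction-transfer φ (++⁻ˡ (disjuncts φ) nfs) cφ (m⊔n≤o⇒m≤o _ _ d≤) σ pσ s)
      disjunction-transfer (φ ∨' ψ) nfs (cφ , cψ) d≤ σ pσ (inj₂ t) =
        inj₂ (disjunction-transfer ψ (++⁻ʳ (disjuncts φ) nfs) cψ (m⊔n≤o⇒n≤o (depth φ) _ d≤) σ pσ t)
      disjunction-transfer (pos p)   (nf ∷ []) = fsnfConj-transfer _ nf
      disjunction-transfer (neg p)   (nf ∷ []) = fsnfConj-transfer _ nf
      disjunction-transfer (_ ∧' _)  (nf ∷ []) = fsnfConj-transfer _ nf
      disjunction-transfer (ex z φ)  (nf ∷ []) = fsnfConj-transfer _ nf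
      disjunction-transfer (all z φ) (nf ∷ []) = fsnfConj-transfer _ nf
      disjunction-transfer (box z φ) (nf ∷ []) = fsnfConj-transfer _ nf
      disjunction-transfer (dia z φ) (nf ∷ []) = fsnfConj-transfer _ nf

    realisable : ∀ n → n ≤ N → Realisable (suc n)
    realisable n n≤N w f f∈δ = do
      E ← extension n≤N f f∈δ
      X ← node E
      return ((val X , children X) , λ { φ (fsnf-dnf nfs) → disjunction-transfer E X (ih n n≤N) φ nfs })
      where
      -- Children of a world of height `n` have height one less, which is what `Realisable n`
      -- supplies; a leaf never asks for any.
      ih : ∀ m → m ≤ N → 1 ≤ m → Realisable m
      ih (suc m) m<N _ = realisable m (≤-trans (n≤1+n m) m<N)

-- The bound and the bounded model.

agentBound : Form → ℕ
agentBound θ = size (TreeModel.finite-Agent (modules θ) (props θ) (depth θ))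

bounded-model : ∀ θ → Sentence θ → FSNFDNF θ → Satisfiable θ → SatisfiableWithAgents≤ (agentBound θ) θ
bounded-model θ closed nf (M , w , σ , s) =
  treeModel , (idx finite-Agent , idx-injective finite-Agent) , (depth θ , proj₁ found) , const root , proj₂ found
  where
  open TreeModel (modules θ) (props θ) (depth θ)

  d₀ = Model.δ-nonempty M w

  -- `σ` may take values outside the domain of `w`, whereas the imitated map must stay inside it. As
  -- `θ` is closed, a constant assignment does as well.
  s₀ : Sat M w (const (proj₁ d₀)) θ
  s₀ = Sat-cong M θ (λ z fr → ⊥-elim (closed z fr)) s

  found : ∃[ u ] ((depth θ , u) ⊩ θ ⟨ const root ⟩)
  found = decidable-stable (any? (finite-Tree (suc (depth θ))) (λ u → ⊩? θ (depth θ , u) (const root))) do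
    u , pres ← Transfer.realisable M (depth θ) ≤-refl w (const (proj₁ d₀)) (const (proj₂ d₀))
    return (u , pres θ nf (covered θ ⊆-refl ⊆-refl) ≤-refl (const root) (const tt) s₀)

theorem1 : Σ (Form → ℕ) λ f →
    ∀ θ → Sentence θ → FSNFDNF θ →
    (Satisfiable θ → SatisfiableWithAgents≤ (f θ) θ)
    × (SatisfiableWithAgents≤ (f θ) θ → Satisfiable θ)
theorem1 = agentBound , λ θ closed nf → bounded-model θ closed nf , λ (M , _ , sat) → M , sat
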